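{- Let $L$ be either of the sequent calculi $\mathrm{sMC}^*$, $\mathrm{sCN}^*$. For every formula $\alpha$ and every finite set $\Gamma$ of formulas, the sequent $\alpha,\Gamma\Rightarrow\alpha$ is provable in $L$.
   Context: Formulas are built from countably many propositional variables $p,q,\dots$ using the binary connectives $\land,\lor,\to$ and the unary connective $\sim$. A sequent is an expression $\Gamma\Rightarrow\gamma$ with $\Gamma$ a finite (possibly empty) set of formulas and $\gamma$ a single formula; $\alpha,\Gamma$ means $\{\alpha\}\cup\Gamma$ and $\Gamma,\Delta$ means $\Gamma\cup\Delta$. The calculus $\mathrm{sC}$ has the following initial sequents and rules ($p$ any propositional variable; $\alpha,\beta,\gamma$ any formulas; $\Gamma,\Delta,\Sigma$ any finite sets of formulas). Initial sequents: (init1) $p,\Gamma\Rightarrow p$; (init2) $\sim p,\Gamma\Rightarrow\sim p$. (cut): from $\Gamma\Rightarrow\alpha$ and $\alpha,\Sigma\Rightarrow\gamma$ infer $\Gamma,\Sigma\Rightarrow\gamma$. ($\to$left): from $\Gamma\Rightarrow\alpha$ and $\beta,\Delta\Rightarrow\gamma$ infer $\alpha\to\beta,\Gamma,\Delta\Rightarrow\gamma$. ($\to$right): from $\alpha,\Gamma\Rightarrow\beta$ infer $\Gamma\Rightarrow\alpha\to\beta$. ($\land$left): from $\alpha,\beta,\Gamma\Rightarrow\gamma$ infer $\alpha\land\beta,\Gamma\Rightarrow\gamma$. ($\land$right): from $\Gamma\Rightarrow\alpha$ and $\Gamma\Rightarrow\beta$ infer $\Gamma\Rightarrow\alpha\land\beta$.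 ($\lor$left): from $\alpha,\Gamma\Rightarrow\gamma$ and $\beta,\Gamma\Rightarrow\gamma$ infer $\alpha\lor\beta,\Gamma\Rightarrow\gamma$. ($\lor$right1), ($\lor$right2): from $\Gamma\Rightarrow\alpha$ (respectively $\Gamma\Rightarrow\beta$) infer $\Gamma\Rightarrow\alpha\lor\beta$. ($\sim$left): from $\alpha,\Gamma\Rightarrow\gamma$ infer $\sim\sim\alpha,\Gamma\Rightarrow\gamma$. ($\sim$right): from $\Gamma\Rightarrow\alpha$ infer $\Gamma\Rightarrow\sim\sim\alpha$. ($\sim\to$left): from $\Gamma\Rightarrow\alpha$ and $\sim\beta,\Delta\Rightarrow\gamma$ infer $\sim(\alpha\to\beta),\Gamma,\Delta\Rightarrow\gamma$. ($\sim\to$right): from $\alpha,\Gamma\Rightarrow\sim\beta$ infer $\Gamma\Rightarrow\sim(\alpha\to\beta)$. ($\sim\land$left): from $\sim\alpha,\Gamma\Rightarrow\gamma$ and $\sim\beta,\Gamma\Rightarrow\gamma$ infer $\sim(\alpha\land\beta),\Gamma\Rightarrow\gamma$. ($\sim\land$right1), ($\sim\land$right2): from $\Gamma\Rightarrow\sim\alpha$ (respectively $\Gamma\Rightarrow\sim\beta$) infer $\Gamma\Rightarrow\sim(\alpha\land\beta)$. ($\sim\lor$left): from $\sim\alpha,\sim\beta,\Gamma\Rightarrow\gamma$ infer $\sim(\alpha\lor\beta),\Gamma\Rightarrow\gamma$. ($\sim\lor$right): from $\Gamma\Rightarrow\sim\alpha$ and $\Gamma\Rightarrow\sim\beta$ infer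 $\Gamma\Rightarrow\sim(\alpha\lor\beta)$. Additional rules: (ex-middle): from $\sim\alpha,\Gamma\Rightarrow\gamma$ and $\alpha,\Gamma\Rightarrow\gamma$ infer $\Gamma\Rightarrow\gamma$. (g-ex-middle): from $\alpha\to\beta,\Gamma\Rightarrow\gamma$ and $\alpha,\Gamma\Rightarrow\gamma$ infer $\Gamma\Rightarrow\gamma$. $\mathrm{sMC}^*=\mathrm{sC}+$(g-ex-middle); $\mathrm{sCN}^*=\mathrm{sC}+$(ex-middle)$+$(g-ex-middle). -}

module Defs where

open import Data.Nat.Base using (ℕ)
open import Data.List.Base using (List; []; _∷_; _++_)
open import Data.List.Membership.Propositional using (_∈_)
open import Data.List.Relation.Binary.BagAndSetEquality using (_∼[_]_; set)

infix  9 ∼_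
infixr 8 _∧_
infixr 7 _∨_
infixr 6 _⊃_

-- _⊃_ is the object-level implication.
data Formula : Set where
  var         : ℕ → Formula
  _∧_ _∨_ _⊃_ : Formula → Formula → Formula
  ∼_          : Formula → Formula

-- A finite set of formulas is represented by a list of its elements, in any
-- order and with any repetitions: _∷_ is insertion and _++_ is union.  Two lists
-- denote the same set when they are related by _∼[ set ]_.
FinSet : Set
FinSet = List Formula

data AdditionalRule : Set where
  ex-middle g-ex-middle : AdditionalRule

-- A calculus sC + (r₁) + … + (rₙ) is given by the list of rules added to sC.
Calculus : Set
Calculus = List AdditionalRule

sC sMC* sCN* : Calculus
sC   = []
sMC* = g-ex-middle ∷ []
sCN* = ex-middle ∷ g-ex-middle ∷ []

infix 3 _⊢_⇒_

data _⊢_⇒_ (L : Calculus) : FinSet → Formula → Set where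

  -- Not a rule of the calculus: it identifies sequents whose antecedents are the
  -- same set.
  set-eq : ∀ {Γ Δ γ} → Γ ∼[ set ] Δ → L ⊢ Γ ⇒ γ → L ⊢ Δ ⇒ γ

  init1 : ∀ {p Γ} → L ⊢ var p ∷ Γ ⇒ var p
  init2 : ∀ {p Γ} → L ⊢ ∼ var p ∷ Γ ⇒ ∼ var p

  cut : ∀ {α γ Γ Σ} → L ⊢ Γ ⇒ α → L ⊢ α ∷ Σ ⇒ γ → L ⊢ Γ ++ Σ ⇒ γ

  ⊃left  : ∀ {α β γ Γ Δ} → L ⊢ Γ ⇒ α → L ⊢ β ∷ Δ ⇒ γ → L ⊢ α ⊃ β ∷ Γ ++ Δ ⇒ γ
  ⊃right : ∀ {α β Γ} → L ⊢ α ∷ Γ ⇒ β → L ⊢ Γ ⇒ α ⊃ β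

  ∧left  : ∀ {α β γ Γ} → L ⊢ α ∷ β ∷ Γ ⇒ γ → L ⊢ α ∧ β ∷ Γ ⇒ γ
  ∧right : ∀ {α β Γ} → L ⊢ Γ ⇒ α → L ⊢ Γ ⇒ β → L ⊢ Γ ⇒ α ∧ β

  ∨left   : ∀ {α β γ Γ} → L ⊢ α ∷ Γ ⇒ γ → L ⊢ β ∷ Γ ⇒ γ → L ⊢ α ∨ β ∷ Γ ⇒ γ
  ∨right1 : ∀ {α β Γ} → L ⊢ Γ ⇒ α → L ⊢ Γ ⇒ α ∨ β
  ∨right2 : ∀ {α β Γ} → L ⊢ Γ ⇒ β → L ⊢ Γ ⇒ α ∨ β

  ∼left  : ∀ {α γ Γ} → L ⊢ α ∷ Γ ⇒ γ → L ⊢ ∼ ∼ α ∷ Γ ⇒ γ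
  ∼right : ∀ {α Γ} → L ⊢ Γ ⇒ α → L ⊢ Γ ⇒ ∼ ∼ α

  ∼⊃left  : ∀ {α β γ Γ Δ} → L ⊢ Γ ⇒ α → L ⊢ ∼ β ∷ Δ ⇒ γ → L ⊢ ∼ (α ⊃ β) ∷ Γ ++ Δ ⇒ γ
  ∼⊃right : ∀ {α β Γ} → L ⊢ α ∷ Γ ⇒ ∼ β → L ⊢ Γ ⇒ ∼ (α ⊃ β)

  ∼∧left   : ∀ {α β γ Γ} → L ⊢ ∼ α ∷ Γ ⇒ γ → L ⊢ ∼ β ∷ Γ ⇒ γ → L ⊢ ∼ (α ∧ β) ∷ Γ ⇒ γ
  ∼∧right1 : ∀ {α β Γ} → L ⊢ Γ ⇒ ∼ α → L ⊢ Γ ⇒ ∼ (α ∧ β)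
  ∼∧right2 : ∀ {α β Γ} → L ⊢ Γ ⇒ ∼ β → L ⊢ Γ ⇒ ∼ (α ∧ β)

  ∼∨left  : ∀ {α β γ Γ} → L ⊢ ∼ α ∷ ∼ β ∷ Γ ⇒ γ → L ⊢ ∼ (α ∨ β) ∷ Γ ⇒ γ
  ∼∨right : ∀ {α β Γ} → L ⊢ Γ ⇒ ∼ α → L ⊢ Γ ⇒ ∼ β → L ⊢ Γ ⇒ ∼ (α ∨ β)

  by-ex-middle   : ∀ {α γ Γ} → ex-middle ∈ L →
                   L ⊢ ∼ α ∷ Γ ⇒ γ → L ⊢ α ∷ Γ ⇒ γ → L ⊢ Γ ⇒ γ
  by-g-ex-middle : ∀ {α β γ Γ} → g-ex-middle ∈ L →
                   L ⊢ α ⊃ β ∷ Γ ⇒ γ → L ⊢ α ∷ Γ ⇒ γ → L ⊢ Γ ⇒ γ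

{-# OPTIONS --safe #-}
module Submission where

open import Data.List.Base using (_∷_; [])
open import Data.List.Relation.Binary.BagAndSetEquality using (bag-=⇒; ↭⇒∼bag)
open import Data.List.Relation.Binary.Permutation.Propositional using (↭-refl; swap)
open import Data.Sum.Base using (_⊎_)
open import Relation.Binary.PropositionalEquality using (_≡_)
open import Defs

-- By induction on the formula, the left and right rules of each connective, plain or negated,
-- match: together they reduce its identity sequent to those of its parts, ending in initial
-- sequents. The rules of `sC`, common to both calculi, suffice.

exchange : ∀ {L α β γ Γ} → L ⊢ α ∷ β ∷ Γ ⇒ γ → L ⊢ β ∷ α ∷ Γ ⇒ γ
exchange {α = α} {β} = set-eq (bag-=⇒ (↭⇒∼bag (swap α β ↭-refl)))

-- The left rules for ∼ (α ∘ β) have premises about ∼ α and ∼ β, which are not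
-- subformulas; hence the simultaneous induction for α and ∼ α.
identity  : ∀ {L} α Γ → L ⊢ α ∷ Γ ⇒ α
identity∼ : ∀ {L} α Γ → L ⊢ ∼ α ∷ Γ ⇒ ∼ α

identity (var p) Γ = init1
identity (α ∧ β) Γ = ∧left (∧right (identity α (β ∷ Γ)) (exchange (identity β (α ∷ Γ))))
identity (α ∨ β) Γ = ∨left (∨right1 (identity α Γ)) (∨right2 (identity β Γ))
-- All of `Γ` goes to the second premise, so the union `(α ∷ []) ++ Γ` computes to `α ∷ Γ`.
identity (α ⊃ β) Γ = ⊃right (exchange (⊃left (identity α []) (identity β Γ)))
identity (∼ α)   Γ = identity∼ α Γ

identity∼ (var p) Γ = init2
identity∼ (α ∧ β) Γ = ∼∧left (∼∧right1 (identity∼ α Γ)) (∼∧right2 (identity∼ β Γ))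
identity∼ (α ∨ β) Γ =
  ∼∨left (∼∨right (identity∼ α (∼ β ∷ Γ)) (exchange (identity∼ β (∼ α ∷ Γ))))
identity∼ (α ⊃ β) Γ = ∼⊃right (exchange (∼⊃left (identity α []) (identity∼ β Γ)))
identity∼ (∼ α)   Γ = ∼left (∼right (identity α Γ))

proposition2p10 : (L : Calculus) → L ≡ sMC* ⊎ L ≡ sCN* →
    (α : Formula) (Γ : FinSet) → L ⊢ α ∷ Γ ⇒ α
proposition2p10 L _ = identity
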